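{- Given value oracle access to a coverage function $f:2^{[m]}\to\mathbb{R}_{\ge 0}$ whose sets of positive weight are $\{S_1,\dots,S_n\}$ (that is, $w(S_i)>0$ for each $i$ and all other $W$-coefficients of $f$ are $0$), the procedure Recover Coverage (described in the context) returns the correct weights, that is, the sets $S_1,\dots,S_n$ with their weights $w(S_1),\dots,w(S_n)$, with $O(mn)$ queries to the oracle.
   Context: $[m]=\{1,\dots,m\}$. A function $f:2^{[m]}\to\mathbb{R}_{\ge 0}$ is a coverage function if there exist a universe $U$ of elements with weights $w_u\ge 0$ and sets $A_1,\dots,A_m\subseteq U$ such that $f(T)=\sum_{u\in\bigcup_{i\in T}A_i} w_u$ for all $T\subseteq[m]$. The $W$-coefficients of $f$ are, for each non-empty $S\subseteq[m]$, $w(S)=\sum_{T:\,S\cup T=[m]}(-1)^{|S\cap T|+1}f(T)$; they satisfy $f(T)=\sum_{S:\,S\cap T\ne\emptyset}w(S)$ for all $T\subseteq[m]$. A value oracle for $f$ returns $f(T)$ when queried on $T\subseteq[m]$. Notation: a vector $x\in\{0,1\}^k$ is identified with the subset $\{i\in[k]:x(i)=1\}$ of $[k]$. Let $\mathcal{F}(x)=\{S\subseteq[m]:S\cap[k]=x\}$ and let $w(\mathcal{F}(x))$ be the total weight $\sum_{S\in\mathcal{F}(x)}w(S)$ (for $k=0$ and $x$ the empty vector, $\mathcal{F}(x)$ is the collection of all subsets of $[m]$). For $b\in\{0,1\}$, $x\oplus b\in\{0,1\}^{k+1}$ is $x$ with $b$ appended. Procedure Refine. Input: $k$ and the values $w(\mathcal{F}(x))>0$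 for $x\in\{0,1\}^k$ (those $x$ for which this weight is positive). Output: the values $w(\mathcal{F}(x\oplus 0))$ and $w(\mathcal{F}(x\oplus 1))$. Order the vectors $x$ with $w(\mathcal{F}(x))>0$ by increasing number of 1's, breaking ties arbitrarily, as $x_1,\dots,x_N$. For $i=1,\dots,N$: query $F_i^0=f([k]\setminus x_i)$ and $F_i^1=f(([k]\setminus x_i)\cup\{k+1\})$; define $\Delta_{x_i}=F_i^1-F_i^0-\sum_{j<i}\Delta_{x_j}$; set $w(\mathcal{F}(x_i\oplus 1))=\Delta_{x_i}$ and $w(\mathcal{F}(x_i\oplus 0))=w(\mathcal{F}(x_i))-\Delta_{x_i}$. Procedure Recover Coverage. Input: a value oracle to a coverage function $f$. Start with a list $L$ containing only the empty vector $x$ (level $k=0$), with $w(\mathcal{F}(x))=f([m])$. In each of $m$ successive rounds, run Refine on the vectors $x$ in $L$ (in the $k$-th round these are vectors in $\{0,1\}^{k-1}$), remove them from $L$, and add $x\oplus 0$ and $x\oplus 1$ to $L$ only if their computed weights are positive. After $m$ rounds, for each $x\in\{0,1\}^m$ in $L$, return the corresponding set and the weight calculated for it by Refine.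
   Formalization: In Refine the sum of Δ_{x_j} is taken only over those j<i with x_j ⊆ x_i, since subtracting over all j<i returns wrong weights (e.g. m=3, w({1,3})=w({2,3})=1). The query bound is stated for n ≥ 1, with m ≥ 1, over any ordered field with decidable order. -}

module Defs where

open import Algebra.Bundles using (CommutativeRing)
import Data.Bool.Properties as Bool
open import Data.Fin.Base using (Fin; fromℕ<)
open import Data.Fin.Subset
  using (Subset; inside; outside; ⊤; _∈_; ∁; _∪_; _∩_; ⋃; ⁅_⁆; ∣_∣; Nonempty)
open import Data.Fin.Subset.Properties using (_∈?_; _⊆?_)
open import Data.List.Base using (List; []; _∷_; _++_; map; filter; foldr; allFin)
open import Data.List.Sort.Base using (SortingAlgorithm)
open import Data.Nat.Base as ℕ using (ℕ; zero; suc)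
import Data.Nat.Properties as ℕ
open import Data.Product.Base using (∃; _×_; _,_; proj₁; proj₂)
open import Data.Product.Relation.Binary.Pointwise.NonDependent using (×-setoid)
open import Data.Vec.Base using ([]; _∷_; _∷ʳ_; padRight)
import Data.Vec.Properties as Vec
open import Function.Definitions using (Injective)
open import Level using (_⊔_; 0ℓ) renaming (suc to lsuc)
open import Relation.Binary.Bundles using (Setoid; TotalOrder)
open import Relation.Binary.Core using (Rel)
open import Relation.Binary.Definitions using (Decidable)
import Relation.Binary.Construct.NonStrictToStrict as ToStrict
import Relation.Binary.Construct.On as On
open import Relation.Binary.PropositionalEquality using (_≡_; setoid)
open import Relation.Binary.Structures using (IsDecTotalOrder)
open import Relation.Nullary using (¬_)

-- The library has no real numbers.  Everything below is done over an
-- arbitrary ordered field; `≤` and `≈` are decidable because the procedure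
-- branches on whether a computed real number is positive.

record OrderedField c ℓ₁ ℓ₂ : Set (lsuc (c ⊔ ℓ₁ ⊔ ℓ₂)) where
  infix 4 _≤_ _<_ _<?_
  field
    commutativeRing : CommutativeRing c ℓ₁

  open CommutativeRing commutativeRing public
    renaming (setoid to ≈-setoid; isEquivalence to ≈-isEquivalence)

  field
    _≤_             : Rel Carrier ℓ₂
    isDecTotalOrder : IsDecTotalOrder _≈_ _≤_
    +-monoˡ-≤       : ∀ z {x y} → x ≤ y → x + z ≤ y + z
    *-nonNeg        : ∀ {x y} → 0# ≤ x → 0# ≤ y → 0# ≤ x * y
    0≉1             : ¬ 0# ≈ 1#
    inverse         : ∀ x → ¬ x ≈ 0# → ∃ λ y → x * y ≈ 1#

  module Order = IsDecTotalOrder isDecTotalOrder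

  _<_ : Rel Carrier (ℓ₁ ⊔ ℓ₂)
  _<_ = ToStrict._<_ _≈_ _≤_

  _<?_ : Decidable _<_
  _<?_ = ToStrict.<-decidable _≈_ _≤_ Order._≟_ Order._≤?_

-- The set [m] is `Fin m`, the element i ∈ [m] being the index i - 1, and a
-- vector in {0,1}^k is the same thing as a `Subset k`.

elements : ∀ {n} → Subset n → List (Fin n)
elements p = filter (_∈? p) (allFin _)

subsets : ∀ n → List (Subset n)
subsets zero    = [] ∷ []
subsets (suc n) = map (outside ∷_) (subsets n) ++ map (inside ∷_) (subsets n)

module Coverage {c ℓ₁ ℓ₂} (R : OrderedField c ℓ₁ ℓ₂) where
  open OrderedField R
  open import Algebra.Properties.Semiring.Exp semiring using (_^_)

  ∑ : ∀ {a} {A : Set a} → List A → (A → Carrier) → Carrier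
  ∑ xs g = foldr _+_ 0# (map g xs)

  record IsCoverage {m} (f : Subset m → Carrier) : Set (c ⊔ ℓ₁ ⊔ ℓ₂) where
    field
      size     : ℕ
      weight   : Fin size → Carrier
      weight≥0 : ∀ u → 0# ≤ weight u
      A        : Fin m → Subset size
      f≈       : ∀ T → f T ≈ ∑ (elements (⋃ (map A (elements T)))) weight

  W : ∀ {m} → (Subset m → Carrier) → Subset m → Carrier
  W {m} f S = ∑ (filter (λ T → (S ∪ T) ≟ ⊤) (subsets m))
                (λ T → (- 1#) ^ (∣ S ∩ T ∣ ℕ.+ 1) * f T)
    where _≟_ = Vec.≡-dec Bool._≟_

  -- W-coefficients are indexed by non-empty sets only.
  record PositiveSets {m n} (f : Subset m → Carrier) (S : Fin n → Subset m)
                      : Set (c ⊔ ℓ₁ ⊔ ℓ₂) where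
    field
      distinct : Injective _≡_ _≡_ S
      nonempty : ∀ i → Nonempty (S i)
      positive : ∀ i → 0# < W f (S i)
      others   : ∀ T → Nonempty T → (∀ i → ¬ T ≡ S i) → W f T ≈ 0#

  -- Computations whose only access to f is through value queries.
  data OracleComp (m : ℕ) {a} (X : Set a) : Set (a ⊔ c) where
    return : X → OracleComp m X
    query  : Subset m → (Carrier → OracleComp m X) → OracleComp m X

  module _ {m : ℕ} where
    infixl 1 _>>=_

    _>>=_ : ∀ {a b} {X : Set a} {Y : Set b} →
            OracleComp m X → (X → OracleComp m Y) → OracleComp m Y
    return x  >>= h = h x
    query T g >>= h = query T (λ v → g v >>= h)

    result : ∀ {a} {X : Set a} → (Subset m → Carrier) → OracleComp m X → X
    result f (return x)  = x
    result f (query T g) = result f (g (f T))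

    queries : ∀ {a} {X : Set a} → (Subset m → Carrier) → OracleComp m X → ℕ
    queries f (return x)  = 0
    queries f (query T g) = suc (queries f (g (f T)))

  -- A vector x together with the computed value of w(F(x)).
  Entry : ℕ → Set c
  Entry k = Subset k × Carrier

  onlyPositive : ∀ {k} → List (Entry k) → List (Entry k)
  onlyPositive = filter (λ e → 0# <? proj₂ e)

  byOnes : ℕ → TotalOrder c 0ℓ 0ℓ
  byOnes k = On.totalOrder ℕ.≤-totalOrder (λ (e : Entry k) → ∣ proj₁ e ∣)

  -- An arbitrary algorithm sorting by the number of 1's is an arbitrary way
  -- of breaking ties.
  TieBreaking : Set c
  TieBreaking = ∀ k → SortingAlgorithm (byOnes k)

  -- `done` holds the pairs (x_j , Δ_{x_j}) with j < i.
  --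
  -- Since F¹ - F⁰ is the total weight of the sets S with k+1 ∈ S and
  -- S ∩ [k] ⊆ x_i, what has to be subtracted from it is the sum of the Δ_{x_j}
  -- over those j < i with x_j ⊆ x_i.  Subtracting Δ_{x_j} for all j < i gives
  -- wrong weights: if w({1,3}) = w({2,3}) = 1 are the only non-zero
  -- W-coefficients for m = 3, then for k = 2 the vectors are 10 and 01 (in
  -- either order), both differences F¹ - F⁰ are 1, and the second Δ would be
  -- 0 instead of 1.
  refineLoop : ∀ {m k} → k ℕ.< m → (done todo : List (Entry k)) →
               OracleComp m (List (Entry (suc k)))
  refineLoop             k<m done []             = return []
  refineLoop {m = m} {k} k<m done ((x , wx) ∷ L) =
    query [k]∖x              λ F⁰ →
    query ([k]∖x ∪ ⁅ k+1 ⁆)  λ F¹ →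
    let Δ = F¹ - F⁰ - ∑ (filter (λ e → proj₁ e ⊆? x) done) proj₂ in
    refineLoop k<m ((x , Δ) ∷ done) L >>= λ L′ →
    return ((x ∷ʳ outside , wx - Δ) ∷ (x ∷ʳ inside , Δ) ∷ L′)
    where
    [k]∖x : Subset m
    [k]∖x = padRight (ℕ.<⇒≤ k<m) outside (∁ x)

    k+1 : Fin m
    k+1 = fromℕ< k<m

  module _ (order : TieBreaking) where

    refine : ∀ {m k} → k ℕ.< m → List (Entry k) →
             OracleComp m (List (Entry (suc k)))
    refine {k = k} k<m L = refineLoop k<m [] (sort (onlyPositive L))
      where open SortingAlgorithm (order k)

    -- The list L after k rounds.
    rounds : ∀ {m} k → k ℕ.≤ m → OracleComp m (List (Entry k))
    rounds zero    _   = query ⊤ λ v → return (([] , v) ∷ [])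
    rounds (suc k) k<m =
      rounds k (ℕ.<⇒≤ k<m) >>= λ L →
      refine k<m L         >>= λ L′ →
      return (onlyPositive L′)

    recoverCoverage : ∀ m → OracleComp m (List (Subset m × Carrier))
    recoverCoverage m = rounds m ℕ.≤-refl

  entrySetoid : ℕ → Setoid c ℓ₁
  entrySetoid m = ×-setoid (setoid (Subset m)) ≈-setoid

  -- Equality of lists of weighted sets up to reordering.
  infix 4 _≋_
  _≋_ : ∀ {m} → Rel (List (Subset m × Carrier)) (c ⊔ ℓ₁)
  _≋_ {m} = Permutation._↭_
    where import Data.List.Relation.Binary.Permutation.Setoid (entrySetoid m) as Permutation

-- Möbius inversion gives Σ_{S ∩ T = ∅} W(S) = - f(T), the empty S included.
-- With [k] ∖ x as T, the difference F¹ - F⁰ is therefore the total weight of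
-- the S containing k+1 whose trace on [k] lies below x.  A trace strictly below
-- x that carries weight has fewer 1's, so its Δ is already known when x is
-- treated, and subtracting these leaves w(F(x ⊕ 1)).  All weights are
-- non-negative, so the prefixes kept in each round are exactly the traces of
-- S₁, …, Sₙ; there are at most n of them, and each costs two queries.
module Submission where

open import Defs
open import Algebra.Bundles using (CommutativeMonoid)
import Algebra.Properties.AbelianGroup as AbelianGroupProperties
import Algebra.Properties.CommutativeSemigroup as CommutativeSemigroupProperties
import Algebra.Properties.Ring as RingProperties
open import Data.Bool.Base using (Bool; true; false; not; _∧_; _∨_)
import Data.Bool.Properties as Bool
open import Data.Empty using (⊥-elim)
open import Data.Fin.Base using (Fin; zero; suc; fromℕ<)
import Data.Fin.Properties as Fin
open import Data.Fin.Subset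
  using (Subset; inside; outside; ⊤; ⊥; ∁; _∪_; _∩_; ⁅_⁆; ∣_∣; Nonempty; _⊆_; ⋃)
import Data.Fin.Subset.Properties as Subset
open import Data.Fin.Subset.Properties using (_⊆?_)
open import Data.List.Base
  using (List; []; _∷_; _++_; map; filter; tabulate; length; lookup; allFin)
import Data.List.Properties as List
open import Data.List.Membership.Propositional using (_∈_)
import Data.List.Membership.Propositional.Properties as Membership
open import Data.List.Membership.Propositional.Properties.WithK using (unique∧set⇒bag)
open import Data.List.Relation.Binary.BagAndSetEquality using (∼bag⇒↭)
import Data.List.Relation.Binary.Permutation.Homogeneous as Homogeneous
open import Data.List.Relation.Binary.Permutation.Propositional using (_↭_; ↭⇒↭ₛ; ↭-sym)
import Data.List.Relation.Binary.Permutation.Propositional.Properties as Perm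
import Data.List.Relation.Binary.Permutation.Setoid.Properties as PermSetoid
open import Data.List.Relation.Binary.Pointwise.Base using (Pointwise; []; _∷_)
open import Data.List.Relation.Unary.All as All using (All; []; _∷_)
import Data.List.Relation.Unary.All.Properties as All
open import Data.List.Relation.Unary.AllPairs as AllPairs using (AllPairs; []; _∷_)
import Data.List.Relation.Unary.AllPairs.Properties as AllPairs
open import Data.List.Relation.Unary.Any using (here; there)
import Data.List.Relation.Unary.Linked.Properties as Linked
open import Data.List.Relation.Unary.Unique.Propositional using (Unique)
import Data.List.Relation.Unary.Unique.Propositional.Properties as Unique
open import Data.List.Sort.Base using (SortingAlgorithm)
import Level
open import Data.Nat.Base as ℕ using (ℕ; zero; suc; NonZero; z≤n; s≤s)
import Data.Nat.Properties as ℕ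
open import Data.Product.Base using (∃; ∃-syntax; _×_; _,_; proj₁; proj₂)
open import Data.Sum.Base using (_⊎_; inj₁; inj₂)
open import Data.Vec.Base as Vec using ([]; _∷_; _∷ʳ_; padRight; truncate)
import Data.Vec.Properties as Vec
open import Function.Base using (_∘_)
open import Function.Bundles using (mk⇔)
open import Relation.Binary.Definitions using (DecidableEquality)
open import Relation.Binary.PropositionalEquality as ≡ using (_≡_; _≢_)
import Relation.Binary.Reasoning.Setoid as SetoidReasoning
open import Relation.Nullary using (¬_; yes; no; does; contradiction)
open import Relation.Nullary.Decidable using (dec-true; dec-false)
open import Relation.Unary using (Pred; Decidable)

-- The Möbius formula is proved by induction on `m`: whether the first element lies in S decides how
-- W(S) is expressed through the two restrictions of `f` obtained by fixing that element in T.
-- Coverage gives f(∅) = 0, which makes the starting value f([m]) the total weight of all non-empty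
-- sets. Sums over families of sets are written as sums over all subsets with Boolean indicator
-- factors, so the identity behind Δ can be checked for one set at a time, by cases on its trace on
-- [k] and its bit at k+1.

-- Disjointness, traces and inclusion of bit vectors

infix 4 _≟_
_≟_ : ∀ {n} → DecidableEquality (Subset n)
_≟_ = Vec.≡-dec Bool._≟_

-- Boolean-valued and recursive along the vectors, so that it can be used as an indicator factor and
-- reduces whenever a sum over subsets is split by the first bit.
disjoint : ∀ {n} → Subset n → Subset n → Bool
disjoint []      []      = true
disjoint (s ∷ S) (t ∷ T) = not (s ∧ t) ∧ disjoint S T

disjoint-⊥ : ∀ {n} (S : Subset n) → disjoint S ⊥ ≡ true
disjoint-⊥ []            = ≡.refl
disjoint-⊥ (outside ∷ S) = disjoint-⊥ S
disjoint-⊥ (inside  ∷ S) = disjoint-⊥ S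

disjoint-⊥ˡ : ∀ {n} (T : Subset n) → disjoint ⊥ T ≡ true
disjoint-⊥ˡ []      = ≡.refl
disjoint-⊥ˡ (_ ∷ T) = disjoint-⊥ˡ T

disjoint-∪⁅⁆ : ∀ {n} (S T : Subset n) i →
               disjoint S (T ∪ ⁅ i ⁆) ≡ disjoint S T ∧ not (Vec.lookup S i)
disjoint-∪⁅⁆ (s ∷ S) (t ∷ T) zero
  rewrite Subset.∪-identityʳ T = lemma s t (disjoint S T)
  where
  lemma : ∀ s t d → not (s ∧ (t ∨ true)) ∧ d ≡ (not (s ∧ t) ∧ d) ∧ not s
  lemma outside t       d = ≡.sym (Bool.∧-identityʳ d)
  lemma inside  outside d = ≡.sym (Bool.∧-zeroʳ d)
  lemma inside  inside  d = ≡.refl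
disjoint-∪⁅⁆ (s ∷ S) (t ∷ T) (suc i)
  rewrite Bool.∨-identityʳ t | disjoint-∪⁅⁆ S T i =
  ≡.sym (Bool.∧-assoc (not (s ∧ t)) (disjoint S T) _)

-- This is why the oracle is asked about complements: positions beyond k are padded with `outside`
-- and impose nothing, while on [k] missing the complement of `x` means staying inside `x`.
disjoint-∁ : ∀ {k m} (k≤m : k ℕ.≤ m) (S : Subset m) (x : Subset k) →
             disjoint S (padRight k≤m outside (∁ x)) ≡ does (truncate k≤m S ⊆? x)
disjoint-∁ z≤n       S             []            = disjoint-⊥ S
disjoint-∁ (s≤s k≤m) (outside ∷ S) (_       ∷ x) = disjoint-∁ k≤m S x
disjoint-∁ (s≤s k≤m) (inside  ∷ S) (outside ∷ x) = ≡.refl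
disjoint-∁ (s≤s k≤m) (inside  ∷ S) (inside  ∷ x) = disjoint-∁ k≤m S x

truncate-∷ʳ : ∀ {k m} (k<m : k ℕ.< m) (S : Subset m) →
              truncate k<m S ≡ truncate (ℕ.<⇒≤ k<m) S ∷ʳ Vec.lookup S (fromℕ< k<m)
truncate-∷ʳ (s≤s z≤n)         (s ∷ S) = ≡.refl
truncate-∷ʳ (s≤s k<m@(s≤s _)) (s ∷ S) = ≡.cong (s ∷_) (truncate-∷ʳ k<m S)

-- A strict inclusion would make the number of 1's strictly smaller. In the loop this excludes that
-- a trace strictly inside `x` is still waiting behind `x` in the sorted list.
⊆∧∣≥∣⇒≡ : ∀ {n} (p x : Subset n) → p ⊆ x → ∣ x ∣ ℕ.≤ ∣ p ∣ → p ≡ x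
⊆∧∣≥∣⇒≡ p x p⊆x ∣x∣≤∣p∣ = Subset.⊆-antisym p⊆x x⊆p
  where
  x⊆p : x ⊆ p
  x⊆p {i} i∈x with i Subset.∈? p
  ... | yes i∈p = i∈p
  ... | no  i∉p =
    contradiction ∣x∣≤∣p∣ (ℕ.<⇒≱ (Subset.p⊂q⇒∣p∣<∣q∣ (p⊆x , i , i∈x , i∉p)))

Nonempty⇒≢⊥ : ∀ {n} {S : Subset n} → Nonempty S → S ≢ ⊥
Nonempty⇒≢⊥ (_ , i∈S) ≡.refl = Subset.∉⊥ i∈S

∈-subsets : ∀ {n} (S : Subset n) → S ∈ subsets n
∈-subsets []            = here ≡.refl
∈-subsets (outside ∷ S) = Membership.∈-++⁺ˡ (Membership.∈-map⁺ _ (∈-subsets S))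
∈-subsets (inside  ∷ S) = Membership.∈-++⁺ʳ _ (Membership.∈-map⁺ _ (∈-subsets S))

-- Duplicate-free lists and their lengths

map-filter : ∀ {a b p} {A : Set a} {B : Set b} {P : Pred B p} (P? : Decidable P)
             (h : A → B) xs → map h (filter (P? ∘ h) xs) ≡ filter P? (map h xs)
map-filter P? h []       = ≡.refl
map-filter P? h (x ∷ xs) with does (P? (h x))
... | false = map-filter P? h xs
... | true  = ≡.cong (h x ∷_) (map-filter P? h xs)

lookup-injective : ∀ {a} {A : Set a} {xs : List A} → Unique xs →
                   ∀ i j → lookup xs i ≡ lookup xs j → i ≡ j
lookup-injective (x∉xs ∷ _)      zero    zero    eq = ≡.refl
lookup-injective (x∉xs ∷ _)      zero    (suc j) eq =
  contradiction eq (All.lookup x∉xs (Membership.∈-lookup j))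
lookup-injective (x∉xs ∷ _)      (suc i) zero    eq =
  contradiction (≡.sym eq) (All.lookup x∉xs (Membership.∈-lookup i))
lookup-injective (_    ∷ unique) (suc i) (suc j) eq = ≡.cong suc (lookup-injective unique i j eq)

-- Choosing for each position an index that `h` sends to its entry gives an injection of positions
-- into `Fin n`: equal indices force equal entries, and there are no repetitions.
length≤ : ∀ {a} {A : Set a} {n} (h : Fin n → A) {xs : List A} → Unique xs →
          All (λ x → ∃ λ i → x ≡ h i) xs → length xs ℕ.≤ n
length≤ h {xs} unique image = Fin.injective⇒≤ {f = proj₁ ∘ preimage} λ {i} {j} eq →
  lookup-injective unique i j
    (≡.trans (proj₂ (preimage i)) (≡.trans (≡.cong h eq) (≡.sym (proj₂ (preimage j)))))
  where
  preimage : ∀ i → ∃ λ j → lookup xs i ≡ h j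
  preimage i = All.lookup image (Membership.∈-lookup i)

-- The vectors that `refineLoop` outputs, whatever the oracle answers. Separating them from the
-- computed values lets uniqueness and completeness be argued about vectors alone.
children : ∀ {k} → List (Subset k) → List (Subset (suc k))
children []       = []
children (x ∷ xs) = (x ∷ʳ outside) ∷ (x ∷ʳ inside) ∷ children xs

∈-children : ∀ {k} {x : Subset k} {xs} b → x ∈ xs → x ∷ʳ b ∈ children xs
∈-children outside (here ≡.refl) = here ≡.refl
∈-children inside  (here ≡.refl) = there (here ≡.refl)
∈-children b       (there x∈xs)  = there (there (∈-children b x∈xs))

children-unique : ∀ {k} {xs : List (Subset k)} → Unique xs → Unique (children xs)
children-unique []                = []
children-unique (x∉xs ∷ unique) =
  ((λ eq → contradiction (Vec.∷ʳ-injectiveʳ _ _ eq) λ ()) ∷ apart x∉xs) ∷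
  apart x∉xs ∷ children-unique unique
  where
  apart : ∀ {k b} {x : Subset k} {xs} → All (x ≢_) xs → All (x ∷ʳ b ≢_) (children xs)
  apart []           = []
  apart (x≢y ∷ x∉ys) =
    (x≢y ∘ Vec.∷ʳ-injectiveˡ _ _) ∷ (x≢y ∘ Vec.∷ʳ-injectiveˡ _ _) ∷ apart x∉ys

-- Finite sums with Boolean indicators

module Sums {c ℓ₁ ℓ₂} (R : OrderedField c ℓ₁ ℓ₂) where
  open OrderedField R
  open Coverage R
  open RingProperties ring using (-1*x≈-x; -‿distribˡ-*)
  open AbelianGroupProperties +-abelianGroup using (⁻¹-∙-comm; ε⁻¹≈ε; xyx⁻¹≈y)
  open CommutativeSemigroupProperties
    (CommutativeMonoid.commutativeSemigroup +-commutativeMonoid) using (interchange)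
  open SetoidReasoning ≈-setoid

  infixr 6.5 _⊙_
  -- An indicator factor. Taking a `Bool` rather than a decision, it reduces as soon as `does` is
  -- known and allows rewriting by equations between Booleans.
  _⊙_ : Bool → Carrier → Carrier
  true  ⊙ v = v
  false ⊙ v = 0#

  ⊙-cong : ∀ b {v w} → v ≈ w → b ⊙ v ≈ b ⊙ w
  ⊙-cong true  v≈w = v≈w
  ⊙-cong false v≈w = refl

  ⊙-zero : ∀ b {v} → v ≈ 0# → b ⊙ v ≈ 0#
  ⊙-zero true  v≈0 = v≈0
  ⊙-zero false v≈0 = refl

  ⊙-+ : ∀ b v w → b ⊙ (v + w) ≈ (b ⊙ v) + (b ⊙ w)
  ⊙-+ true  v w = refl
  ⊙-+ false v w = sym (+-identityˡ 0#)

  ⊙-nonNeg : ∀ b {v} → 0# ≤ v → 0# ≤ b ⊙ v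
  ⊙-nonNeg true  0≤v = 0≤v
  ⊙-nonNeg false 0≤v = Order.refl

  module _ {a} {A : Set a} where

    ∑-cong-All : ∀ {xs : List A} {g h} → All (λ x → g x ≈ h x) xs → ∑ xs g ≈ ∑ xs h
    ∑-cong-All []           = refl
    ∑-cong-All (g≈h ∷ gs≈hs) = +-cong g≈h (∑-cong-All gs≈hs)

    ∑-cong : ∀ (xs : List A) {g h} → (∀ x → g x ≈ h x) → ∑ xs g ≈ ∑ xs h
    ∑-cong xs g≈h = ∑-cong-All (All.universal g≈h xs)

    ∑-zero : ∀ {xs : List A} {g} → All (λ x → g x ≈ 0#) xs → ∑ xs g ≈ 0#
    ∑-zero []           = refl
    ∑-zero (g≈0 ∷ gs≈0) = trans (+-cong g≈0 (∑-zero gs≈0)) (+-identityˡ 0#)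

    ∑-+ : ∀ (xs : List A) g h → ∑ xs (λ x → g x + h x) ≈ ∑ xs g + ∑ xs h
    ∑-+ []       g h = sym (+-identityˡ 0#)
    ∑-+ (x ∷ xs) g h = trans (+-congˡ (∑-+ xs g h)) (interchange (g x) (h x) _ _)

    ∑-neg : ∀ (xs : List A) g → ∑ xs (λ x → - g x) ≈ - ∑ xs g
    ∑-neg []       g = sym ε⁻¹≈ε
    ∑-neg (x ∷ xs) g = trans (+-congˡ (∑-neg xs g)) (⁻¹-∙-comm (g x) _)

    ∑-++ : ∀ (xs ys : List A) g → ∑ (xs ++ ys) g ≈ ∑ xs g + ∑ ys g
    ∑-++ []       ys g = sym (+-identityˡ _)
    ∑-++ (x ∷ xs) ys g = trans (+-congˡ (∑-++ xs ys g)) (sym (+-assoc (g x) _ _))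

    ∑-map : ∀ {b} {B : Set b} (h : B → A) xs g → ∑ (map h xs) g ≡ ∑ xs (g ∘ h)
    ∑-map h []       g = ≡.refl
    ∑-map h (x ∷ xs) g = ≡.cong (g (h x) +_) (∑-map h xs g)

    ∑-filter : ∀ {p} {P : Pred A p} (P? : Decidable P) xs g →
               ∑ (filter P? xs) g ≈ ∑ xs (λ x → does (P? x) ⊙ g x)
    ∑-filter P? []       g = refl
    ∑-filter P? (x ∷ xs) g with does (P? x)
    ... | false = trans (∑-filter P? xs g) (sym (+-identityˡ _))
    ... | true  = +-congˡ (∑-filter P? xs g)

    ∑-single : ∀ {xs : List A} {g x} → Unique xs → x ∈ xs → (∀ y → y ≢ x → g y ≈ 0#) →
               ∑ xs g ≈ g x
    ∑-single (x∉xs ∷ _) (here ≡.refl) g≈0 =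
      trans (+-congˡ (∑-zero (All.map (λ x≢y → g≈0 _ (x≢y ∘ ≡.sym)) x∉xs))) (+-identityʳ _)
    ∑-single (y∉xs ∷ unique) (there x∈xs) g≈0 =
      trans (+-cong (g≈0 _ (All.lookup y∉xs x∈xs)) (∑-single unique x∈xs g≈0)) (+-identityˡ _)

    ∑-nonNeg : ∀ {xs : List A} {g} → (∀ x → 0# ≤ g x) → 0# ≤ ∑ xs g
    ∑-nonNeg {[]}     0≤g = Order.refl
    ∑-nonNeg {x ∷ xs} 0≤g = Order.trans (∑-nonNeg {xs} 0≤g)
      (Order.≤-respˡ-≈ (+-identityˡ _) (+-monoˡ-≤ _ (0≤g x)))

    term≤∑ : ∀ {xs : List A} {g x} → (∀ x → 0# ≤ g x) → x ∈ xs → g x ≤ ∑ xs g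
    term≤∑ {y ∷ xs} {g} 0≤g (here ≡.refl) =
      Order.≤-respˡ-≈ (+-identityˡ _) (Order.≤-respʳ-≈ (+-comm _ _) (+-monoˡ-≤ (g y) (∑-nonNeg {xs} 0≤g)))
    term≤∑ {y ∷ xs} 0≤g (there x∈xs) = Order.trans (term≤∑ 0≤g x∈xs)
      (Order.≤-respˡ-≈ (+-identityˡ _) (+-monoˡ-≤ _ (0≤g y)))

    -- Decidability of `≈` lets the non-zero term be searched for along the list.
    ∑≉0⇒term≉0 : ∀ {xs : List A} {g} → ¬ ∑ xs g ≈ 0# → ∃ λ x → ¬ g x ≈ 0#
    ∑≉0⇒term≉0 {[]}         ∑≉0 = contradiction refl ∑≉0
    ∑≉0⇒term≉0 {x ∷ xs} {g} ∑≉0 with g x Order.≟ 0#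
    ... | no  g≉0 = x , g≉0
    ... | yes g≈0 =
      ∑≉0⇒term≉0 {xs} (∑≉0 ∘ λ ∑≈0 → trans (+-cong g≈0 ∑≈0) (+-identityˡ 0#))

  ∑-swap : ∀ {a b} {A : Set a} {B : Set b} (xs : List A) (ys : List B) (g : A → B → Carrier) →
           ∑ xs (λ x → ∑ ys (g x)) ≈ ∑ ys (λ y → ∑ xs (λ x → g x y))
  ∑-swap []       ys g = sym (∑-zero (All.universal (λ _ → refl) ys))
  ∑-swap (x ∷ xs) ys g = trans (+-congˡ (∑-swap xs ys g)) (sym (∑-+ ys (g x) _))

  ∑-subsets-suc : ∀ {n} (g : Subset (suc n) → Carrier) →
    ∑ (subsets (suc n)) g ≈
    ∑ (subsets n) (λ S → g (outside ∷ S)) + ∑ (subsets n) (λ S → g (inside ∷ S))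
  ∑-subsets-suc {n} g = trans (∑-++ (map (outside ∷_) (subsets n)) _ g)
    (reflexive (≡.cong₂ _+_ (∑-map _ (subsets n) g) (∑-map _ (subsets n) g)))

  ∑-subsets-single : ∀ {n} (x : Subset n) {g} → (∀ S → S ≢ x → g S ≈ 0#) →
                     ∑ (subsets n) g ≈ g x
  ∑-subsets-single x = ∑-single (unique _) (∈-subsets x)
    where
    unique : ∀ n → Unique (subsets n)
    unique zero    = [] ∷ []
    unique (suc n) = Unique.++⁺
      (Unique.map⁺ Vec.∷-injectiveʳ (unique n)) (Unique.map⁺ Vec.∷-injectiveʳ (unique n))
      λ (S∈o , S∈i) → apart (Membership.∈-map⁻ _ S∈o) (Membership.∈-map⁻ _ S∈i)
      where
      apart : ∀ {S : Subset (suc n)} {xs ys} → ∃ (λ S′ → S′ ∈ xs × S ≡ outside ∷ S′) →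
              ∃ (λ S′ → S′ ∈ ys × S ≡ inside ∷ S′) → _
      apart (_ , _ , ≡.refl) (_ , _ , ())

  -- Recursion and Möbius inversion for the W-coefficients

  open import Algebra.Properties.Semiring.Exp semiring using (_^_)

  W-summand : ∀ {m} → (Subset m → Carrier) → Subset m → Subset m → Carrier
  W-summand f S T =
    does ((S ∪ T) ≟ ⊤) ⊙ ((- 1#) ^ (∣ S ∩ T ∣ ℕ.+ 1) * f T)

  W≈∑ : ∀ {m} (f : Subset m → Carrier) S → W f S ≈ ∑ (subsets m) (W-summand f S)
  W≈∑ {m} f S = ∑-filter (λ T → (S ∪ T) ≟ ⊤) (subsets m) _

  -- As S lacks the first element, S ∪ T can be everything only if T contains it. That element stays
  -- out of S ∩ T, so the signs are unchanged.
  W-outside : ∀ {m} (f : Subset (suc m) → Carrier) S →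
              W f (outside ∷ S) ≈ W (f ∘ (inside ∷_)) S
  W-outside {m} f S = begin
    W f (outside ∷ S)
      ≈⟨ trans (W≈∑ f _) (∑-subsets-suc {m} _) ⟩
    ∑ (subsets m) (λ _ → 0#) + ∑ (subsets m) (W-summand (f ∘ (inside ∷_)) S)
      ≈⟨ +-cong (∑-zero (All.universal (λ _ → refl) (subsets m))) (sym (W≈∑ _ S)) ⟩
    0# + W (f ∘ (inside ∷_)) S
      ≈⟨ +-identityˡ _ ⟩
    W (f ∘ (inside ∷_)) S ∎

  -- Now T is free at the first element. Including it enlarges S ∩ T by one and flips the sign,
  -- hence the difference.
  W-inside : ∀ {m} (f : Subset (suc m) → Carrier) S →
             W f (inside ∷ S) ≈ W (f ∘ (outside ∷_)) S - W (f ∘ (inside ∷_)) S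
  W-inside {m} f S = begin
    W f (inside ∷ S)
      ≈⟨ trans (W≈∑ f _) (∑-subsets-suc {m} _) ⟩
    ∑ (subsets m) (W-summand (f ∘ (outside ∷_)) S)
      + ∑ (subsets m) (λ T → W-summand f (inside ∷ S) (inside ∷ T))
      ≈⟨ +-congˡ (∑-cong (subsets m) negate) ⟩
    ∑ (subsets m) (W-summand (f ∘ (outside ∷_)) S)
      + ∑ (subsets m) (λ T → - W-summand (f ∘ (inside ∷_)) S T)
      ≈⟨ +-cong (sym (W≈∑ _ S)) (trans (∑-neg (subsets m) _) (-‿cong (sym (W≈∑ _ S)))) ⟩
    W (f ∘ (outside ∷_)) S - W (f ∘ (inside ∷_)) S ∎
    where
    negate : ∀ T → W-summand f (inside ∷ S) (inside ∷ T) ≈ - W-summand (f ∘ (inside ∷_)) S T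
    negate T with does ((S ∪ T) ≟ ⊤)
    ... | false = sym ε⁻¹≈ε
    ... | true  = trans (*-congʳ (-1*x≈-x _)) (sym (-‿distribˡ-* _ _))

  W-[] : ∀ (f : Subset 0 → Carrier) → W f [] ≈ - f []
  W-[] f = begin
    - 1# * 1# * f [] + 0#  ≈⟨ +-identityʳ _ ⟩
    - 1# * 1# * f []       ≈⟨ *-congʳ (*-identityʳ _) ⟩
    - 1# * f []            ≈⟨ -1*x≈-x _ ⟩
    - f []                 ∎

  -- Together with the empty set only T = [m] covers [m], and it enters with sign (-1)^1.
  W-⊥ : ∀ {m} (f : Subset m → Carrier) → W f ⊥ ≈ - f ⊤
  W-⊥ {zero}  f = W-[] f
  W-⊥ {suc m} f = trans (W-outside f ⊥) (W-⊥ (f ∘ (inside ∷_)))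

  -- Induction on the first element. If T contains it, only the S without it can be disjoint from T,
  -- and `W-outside` passes to a restriction of `f`. If T lacks it, both versions of S occur and
  -- their coefficients telescope to a coefficient of the other restriction.
  ∑-disjoint-W : ∀ {m} (f : Subset m → Carrier) T →
                 ∑ (subsets m) (λ S → disjoint S T ⊙ W f S) ≈ - f T
  ∑-disjoint-W f [] = trans (+-identityʳ _) (W-[] f)
  ∑-disjoint-W {suc m} f (inside ∷ T) = begin
    ∑ (subsets (suc m)) (λ S → disjoint S (inside ∷ T) ⊙ W f S)
      ≈⟨ ∑-subsets-suc {m} _ ⟩
    ∑ (subsets m) (λ S → disjoint S T ⊙ W f (outside ∷ S)) + ∑ (subsets m) (λ _ → 0#)
      ≈⟨ +-cong (∑-cong (subsets m) λ S → ⊙-cong (disjoint S T) (W-outside f S))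
                (∑-zero (All.universal (λ _ → refl) (subsets m))) ⟩
    ∑ (subsets m) (λ S → disjoint S T ⊙ W (f ∘ (inside ∷_)) S) + 0#
      ≈⟨ +-identityʳ _ ⟩
    ∑ (subsets m) (λ S → disjoint S T ⊙ W (f ∘ (inside ∷_)) S)
      ≈⟨ ∑-disjoint-W (f ∘ (inside ∷_)) T ⟩
    - f (inside ∷ T) ∎
  ∑-disjoint-W {suc m} f (outside ∷ T) = begin
    ∑ (subsets (suc m)) (λ S → disjoint S (outside ∷ T) ⊙ W f S)
      ≈⟨ trans (∑-subsets-suc {m} _) (sym (∑-+ (subsets m) _ _)) ⟩
    ∑ (subsets m) (λ S → (disjoint S T ⊙ W f (outside ∷ S)) + (disjoint S T ⊙ W f (inside ∷ S)))
      ≈⟨ ∑-cong (subsets m) (λ S → trans (sym (⊙-+ (disjoint S T) _ _))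
                                         (⊙-cong (disjoint S T) (telescope S))) ⟩
    ∑ (subsets m) (λ S → disjoint S T ⊙ W (f ∘ (outside ∷_)) S)
      ≈⟨ ∑-disjoint-W (f ∘ (outside ∷_)) T ⟩
    - f (outside ∷ T) ∎
    where
    telescope : ∀ S → W f (outside ∷ S) + W f (inside ∷ S) ≈ W (f ∘ (outside ∷_)) S
    telescope S = begin
      W f (outside ∷ S) + W f (inside ∷ S)
        ≈⟨ +-cong (W-outside f S) (W-inside f S) ⟩
      W (f ∘ (inside ∷_)) S + (W (f ∘ (outside ∷_)) S - W (f ∘ (inside ∷_)) S)
        ≈⟨ +-assoc _ _ _ ⟨
      W (f ∘ (inside ∷_)) S + W (f ∘ (outside ∷_)) S - W (f ∘ (inside ∷_)) S
        ≈⟨ xyx⁻¹≈y _ _ ⟩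
      W (f ∘ (outside ∷_)) S ∎

does-∷ʳ : ∀ {n} (p x : Subset n) b c → does (p ∷ʳ b ≟ x ∷ʳ c) ≡ does (p ≟ x) ∧ does (b Bool.≟ c)
does-∷ʳ []      []      b c = Bool.∧-identityʳ _
does-∷ʳ (s ∷ p) (t ∷ x) b c rewrite does-∷ʳ p x b c =
  ≡.sym (Bool.∧-assoc (does (s Bool.≟ t)) (does (p ≟ x)) _)

-- Results and query counts of oracle computations

module Oracle {c ℓ₁ ℓ₂} (R : OrderedField c ℓ₁ ℓ₂) where
  open OrderedField R using (Carrier)
  open Coverage R

  module _ {m} (f : Subset m → Carrier) where

    result->>= : ∀ {a b} {X : Set a} {Y : Set b} (comp : OracleComp m X) (h : X → OracleComp m Y) →
                 result f (comp >>= h) ≡ result f (h (result f comp))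
    result->>= (return x)  h = ≡.refl
    result->>= (query T g) h = result->>= (g (f T)) h

    queries->>= : ∀ {a b} {X : Set a} {Y : Set b} (comp : OracleComp m X) (h : X → OracleComp m Y) →
                  queries f (comp >>= h) ≡ queries f comp ℕ.+ queries f (h (result f comp))
    queries->>= (return x)  h = ≡.refl
    queries->>= (query T g) h = ≡.cong suc (queries->>= (g (f T)) h)

    queries-return : ∀ {a b} {X : Set a} {Y : Set b} (comp : OracleComp m X) (h : X → Y) →
                     queries f (comp >>= return ∘ h) ≡ queries f comp
    queries-return comp h = ≡.trans (queries->>= comp (return ∘ h)) (ℕ.+-identityʳ _)

    refineLoop-keys : ∀ {k} (k<m : k ℕ.< m) done todo →
      map proj₁ (result f (refineLoop k<m done todo)) ≡ children (map proj₁ todo)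
    refineLoop-keys k<m done []             = ≡.refl
    refineLoop-keys k<m done ((x , wx) ∷ L) =
      ≡.trans (≡.cong (map proj₁) (result->>= (refineLoop k<m _ L) _))
              (≡.cong (λ xs → (x ∷ʳ outside) ∷ (x ∷ʳ inside) ∷ xs) (refineLoop-keys k<m _ L))

    refineLoop-queries : ∀ {k} (k<m : k ℕ.< m) done todo →
      queries f (refineLoop k<m done todo) ≡ length todo ℕ.* 2
    refineLoop-queries k<m done []             = ≡.refl
    refineLoop-queries k<m done ((x , wx) ∷ L) = ≡.cong (2 ℕ.+_)
      (≡.trans (queries-return (refineLoop k<m _ L) _) (refineLoop-queries k<m _ L))

-- Prefix weights and the value of Δ

module Recovery {c ℓ₁ ℓ₂} (R : OrderedField c ℓ₁ ℓ₂) where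
  open OrderedField R
  open Coverage R
  open Sums R
  open Oracle R
  open AbelianGroupProperties +-abelianGroup using (xyx⁻¹≈y)
  open RingProperties ring using (+-cancelʳ)
  module ≈-Reasoning = SetoidReasoning ≈-setoid

  coverage-⊥ : ∀ {m} {f : Subset m → Carrier} → IsCoverage f → f ⊥ ≈ 0#
  coverage-⊥ {m} {f} coverage = begin
    f ⊥                                                ≈⟨ f≈ ⊥ ⟩
    ∑ (elements (⋃ (map A (elements ⊥)))) weight
      -- The same fact is used twice: no index lies in the empty T, and then no element of the
      -- universe lies in the empty union.
      ≡⟨ ≡.cong (λ is → ∑ (elements (⋃ (map A is))) weight) elements-⊥ ⟩
    ∑ (elements ⊥) weight                              ≡⟨ ≡.cong (λ us → ∑ us weight) elements-⊥ ⟩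
    0#                                                 ∎
    where
    open ≈-Reasoning
    open IsCoverage coverage
    elements-⊥ : ∀ {n} → elements {n} ⊥ ≡ []
    elements-⊥ {n} = List.filter-none (Subset._∈? ⊥) (All.universal (λ _ → Subset.∉⊥) (allFin n))

  -- The share of a single set with trace `p`, bit `b` at k+1 and weight `v` in the identity behind
  -- Δ. Without k+1 only the first summand on the right can survive. With k+1 that summand vanishes,
  -- and `p` occurs exactly once among `ys` and `x` if it lies inside `x`, and not at all otherwise.
  split-below : ∀ {k} {x : Subset k} {ys} p b v →
    Unique ys → All (_⊆ x) ys → All (x ≢_) ys → (p ⊆ x → p ≢ x → p ∈ ys) →
    does (p ⊆? x) ⊙ v ≈
    ((does (p ⊆? x) ∧ not b) ⊙ v) +
      (∑ ys (λ y → does (p ∷ʳ b ≟ y ∷ʳ inside) ⊙ v) + (does (p ∷ʳ b ≟ x ∷ʳ inside) ⊙ v))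
  split-below {x = x} {ys} p outside v unique ys⊆x x∉ys complete = sym (begin
    ((does (p ⊆? x) ∧ true) ⊙ v) + (∑ ys g + g x)
      ≈⟨ +-cong (reflexive (≡.cong (_⊙ v) (Bool.∧-identityʳ (does (p ⊆? x)))))
                (+-cong (∑-zero (All.universal g≈0 ys)) (g≈0 x)) ⟩
    (does (p ⊆? x) ⊙ v) + (0# + 0#)   ≈⟨ trans (+-congˡ (+-identityˡ 0#)) (+-identityʳ _) ⟩
    does (p ⊆? x) ⊙ v                 ∎)
    where
    open ≈-Reasoning
    g : Subset _ → Carrier
    g y = does (p ∷ʳ outside ≟ y ∷ʳ inside) ⊙ v
    g≈0 : ∀ y → g y ≈ 0#
    g≈0 y rewrite does-∷ʳ p y outside inside | Bool.∧-zeroʳ (does (p ≟ y)) = refl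
  split-below {x = x} {ys} p inside v unique ys⊆x x∉ys complete = sym (begin
    ((does (p ⊆? x) ∧ false) ⊙ v) + (∑ ys g + g x)
      ≈⟨ +-congʳ (reflexive (≡.cong (_⊙ v) (Bool.∧-zeroʳ (does (p ⊆? x))))) ⟩
    0# + (∑ ys g + g x)               ≈⟨ +-identityˡ _ ⟩
    ∑ ys g + g x                      ≈⟨ cases ⟩
    does (p ⊆? x) ⊙ v                 ∎)
    where
    open ≈-Reasoning
    g : Subset _ → Carrier
    g y = does (p ∷ʳ inside ≟ y ∷ʳ inside) ⊙ v
    g-≡ : g p ≈ v
    g-≡ rewrite dec-true (p ∷ʳ inside ≟ p ∷ʳ inside) ≡.refl = refl
    g-≢ : ∀ {y} → p ≢ y → g y ≈ 0#
    g-≢ {y} p≢y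
      rewrite dec-false (p ∷ʳ inside ≟ y ∷ʳ inside) (p≢y ∘ Vec.∷ʳ-injectiveˡ p y) = refl
    cases : ∑ ys g + g x ≈ does (p ⊆? x) ⊙ v
    cases with p ≟ x | p ⊆? x
    ... | yes ≡.refl | yes _   = trans (+-cong (∑-zero (All.map g-≢ x∉ys)) g-≡) (+-identityˡ v)
    ... | yes ≡.refl | no  p⊈p = ⊥-elim (p⊈p Subset.⊆-refl)
    ... | no  p≢x    | yes p⊆x =
      trans (+-cong (trans (∑-single unique (complete p⊆x p≢x) λ y y≢p → g-≢ (y≢p ∘ ≡.sym)) g-≡)
                    (g-≢ p≢x))
            (+-identityʳ v)
    ... | no  p≢x    | no  p⊈x =
      trans (+-cong (∑-zero (All.map (λ { y⊆x → g-≢ λ { ≡.refl → p⊈x y⊆x } }) ys⊆x)) (g-≢ p≢x))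
            (+-identityˡ 0#)

  module _ {m n} {f : Subset m → Carrier} {S : Fin n → Subset m}
           (f-⊥ : f ⊥ ≈ 0#) (positiveSets : PositiveSets f S) where
    open PositiveSets positiveSets

    -- The Möbius formula gives the empty set the coefficient - f(⊤); it has to be
    -- discarded, since ∅ belongs to F(x) for x = 0…0.
    V : Subset m → Carrier
    V T = not (does (T ≟ ⊥)) ⊙ W f T

    V≈W : ∀ {T} → T ≢ ⊥ → V T ≈ W f T
    V≈W {T} T≢⊥ rewrite dec-false (T ≟ ⊥) T≢⊥ = refl

    V-S : ∀ i → V (S i) ≈ W f (S i)
    V-S i = V≈W (Nonempty⇒≢⊥ (nonempty i))

    V-S-positive : ∀ i → 0# < V (S i)
    V-S-positive i = let 0≤W , 0≉W = positive i in
      Order.≤-respʳ-≈ (sym (V-S i)) 0≤W , λ 0≈V → 0≉W (trans 0≈V (V-S i))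

    V-support : ∀ T → ¬ V T ≈ 0# → ∃ λ i → T ≡ S i
    V-support T V≉0 with Fin.any? (λ i → T ≟ S i) | T ≟ ⊥ | Subset.nonempty? T
    ... | yes found | _       | _         = found
    ... | no  _     | yes _   | _         = contradiction refl V≉0
    ... | no  T≢S   | no  _   | yes T≢∅   =
      contradiction (others T T≢∅ λ i T≡S → T≢S (i , T≡S)) V≉0
    ... | no  _     | no  T≢⊥ | no  empty = contradiction (Subset.Empty-unique empty) T≢⊥

    V-nonNeg : ∀ T → 0# ≤ V T
    V-nonNeg T with V T Order.≟ 0#
    ... | yes V≈0 = Order.reflexive (sym V≈0)
    ... | no  V≉0 with i , ≡.refl ← V-support T V≉0 = proj₁ (V-S-positive i)

    V≈W+ : ∀ T → V T ≈ W f T + (does (T ≟ ⊥) ⊙ f ⊤)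
    V≈W+ T with T ≟ ⊥
    ... | yes ≡.refl = sym (trans (+-congʳ (W-⊥ f)) (-‿inverseˡ (f ⊤)))
    ... | no  _      = sym (+-identityʳ (W f T))

    -- Replacing the coefficient - f(⊤) of the empty set by 0 adds f(⊤) to the Möbius sum, because
    -- the empty set is disjoint from every `T`. The right-hand side does not depend on `T`, so
    -- values of `f` can be compared through their disjoint sums.
    f-disjoint : ∀ T → f T + ∑ (subsets m) (λ T′ → disjoint T′ T ⊙ V T′) ≈ f ⊤
    f-disjoint T = begin
      f T + ∑ (subsets m) (λ T′ → disjoint T′ T ⊙ V T′)
        ≈⟨ +-congˡ (∑-cong (subsets m) λ T′ →
             trans (⊙-cong (disjoint T′ T) (V≈W+ T′)) (⊙-+ (disjoint T′ T) _ _)) ⟩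
      f T + ∑ (subsets m) (λ T′ → (disjoint T′ T ⊙ W f T′) + g T′)
        ≈⟨ +-congˡ (trans (∑-+ (subsets m) _ _) (+-cong (∑-disjoint-W f T) ∑g)) ⟩
      f T + (- f T + f ⊤)   ≈⟨ +-assoc _ _ _ ⟨
      f T - f T + f ⊤       ≈⟨ +-congʳ (-‿inverseʳ (f T)) ⟩
      0# + f ⊤              ≈⟨ +-identityˡ _ ⟩
      f ⊤                   ∎
      where
      open ≈-Reasoning
      g : Subset m → Carrier
      g T′ = disjoint T′ T ⊙ (does (T′ ≟ ⊥) ⊙ f ⊤)
      ∑g : ∑ (subsets m) g ≈ f ⊤
      ∑g = trans
        (∑-subsets-single ⊥ λ T′ T′≢⊥ → ⊙-zero (disjoint T′ T)
          (reflexive (≡.cong (_⊙ f ⊤) (dec-false (T′ ≟ ⊥) T′≢⊥))))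
        (reflexive (≡.cong₂ (λ d e → d ⊙ (e ⊙ f ⊤)) (disjoint-⊥ˡ T) (dec-true (⊥ {m} ≟ ⊥) ≡.refl)))

    f-⊤ : f ⊤ ≈ ∑ (subsets m) V
    f-⊤ = begin
      f ⊤                                                   ≈⟨ f-disjoint ⊥ ⟨
      f ⊥ + ∑ (subsets m) (λ T → disjoint T ⊥ ⊙ V T)        ≈⟨ +-cong f-⊥ (∑-cong (subsets m) λ T →
                                                                 reflexive (≡.cong (_⊙ V T) (disjoint-⊥ T))) ⟩
      0# + ∑ (subsets m) V                                  ≈⟨ +-identityˡ _ ⟩
      ∑ (subsets m) V                                       ∎
      where open ≈-Reasoning

    -- The true w(F(x)), against which the computed values are measured.
    prefixWeight : ∀ {k} → k ℕ.≤ m → Subset k → Carrier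
    prefixWeight k≤m x = ∑ (subsets m) (λ T → does (truncate k≤m T ≟ x) ⊙ V T)

    prefixWeight-positive : ∀ {k} (k≤m : k ℕ.≤ m) T → ¬ V T ≈ 0# →
                            0# < prefixWeight k≤m (truncate k≤m T)
    prefixWeight-positive k≤m T V≉0 with i , ≡.refl ← V-support T V≉0 =
      ∑-nonNeg {xs = subsets m} nonNeg ,
      -- If the sum were 0, `V T` would be squeezed between 0 and the sum.
      λ 0≈∑ → V≉0 (Order.antisym (Order.trans V≤∑ (Order.reflexive (sym 0≈∑))) (V-nonNeg T))
      where
      nonNeg : ∀ T′ → 0# ≤ does (truncate k≤m T′ ≟ truncate k≤m T) ⊙ V T′
      nonNeg T′ = ⊙-nonNeg (does (truncate k≤m T′ ≟ truncate k≤m T)) (V-nonNeg T′)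
      V≤∑ : V T ≤ prefixWeight k≤m (truncate k≤m T)
      V≤∑ = Order.≤-respˡ-≈
        (reflexive (≡.cong (_⊙ V T) (dec-true (truncate k≤m T ≟ truncate k≤m T) ≡.refl)))
        (term≤∑ nonNeg (∈-subsets T))

    prefixWeight-support : ∀ {k} (k≤m : k ℕ.≤ m) x → ¬ prefixWeight k≤m x ≈ 0# →
                           ∃ λ i → x ≡ truncate k≤m (S i)
    prefixWeight-support k≤m x w≉0 with T , term≉0 ← ∑≉0⇒term≉0 {xs = subsets m} w≉0
      with truncate k≤m T ≟ x
    ... | no  _      = contradiction refl term≉0
    ... | yes ≡.refl with i , ≡.refl ← V-support T term≉0 = i , ≡.refl

    prefixWeight-full : ∀ x → prefixWeight ℕ.≤-refl x ≈ V x
    prefixWeight-full x = trans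
      (∑-subsets-single x λ T T≢x → reflexive (≡.cong (_⊙ V T)
        (dec-false (truncate ℕ.≤-refl T ≟ x) λ eq → T≢x (≡.trans (≡.sym (Vec.truncate-refl T)) eq))))
      (reflexive (≡.cong (_⊙ V x) (dec-true (truncate ℕ.≤-refl x ≟ x) (Vec.truncate-refl x))))

    prefixWeight-split : ∀ {k} (k<m : k ℕ.< m) x →
      prefixWeight k<m (x ∷ʳ outside) + prefixWeight k<m (x ∷ʳ inside) ≈
      prefixWeight (ℕ.<⇒≤ k<m) x
    prefixWeight-split k<m x = trans (sym (∑-+ (subsets m) _ _)) (∑-cong (subsets m) pointwise)
      where
      pointwise : ∀ T →
        (does (truncate k<m T ≟ x ∷ʳ outside) ⊙ V T) + (does (truncate k<m T ≟ x ∷ʳ inside) ⊙ V T) ≈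
        does (truncate (ℕ.<⇒≤ k<m) T ≟ x) ⊙ V T
      pointwise T
        rewrite truncate-∷ʳ k<m T
              | does-∷ʳ (truncate (ℕ.<⇒≤ k<m) T) x (Vec.lookup T (fromℕ< k<m)) outside
              | does-∷ʳ (truncate (ℕ.<⇒≤ k<m) T) x (Vec.lookup T (fromℕ< k<m)) inside
        with does (truncate (ℕ.<⇒≤ k<m) T ≟ x) | Vec.lookup T (fromℕ< k<m)
      ... | false | _       = +-identityˡ 0#
      ... | true  | outside = +-identityʳ (V T)
      ... | true  | inside  = +-identityˡ (V T)

    -- Here `ys` stands for the treated vectors inside `x`. Only traces of sets with non-zero `V`
    -- are required to be in it, since all other sets contribute 0 to every sum involved.
    Δ-correct : ∀ {k} (k<m : k ℕ.< m) x {ys} →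
      Unique ys → All (_⊆ x) ys → All (x ≢_) ys →
      (∀ T → ¬ V T ≈ 0# → truncate (ℕ.<⇒≤ k<m) T ⊆ x → truncate (ℕ.<⇒≤ k<m) T ≢ x →
        truncate (ℕ.<⇒≤ k<m) T ∈ ys) →
      let [k]∖x = padRight (ℕ.<⇒≤ k<m) outside (∁ x) in
      f ([k]∖x ∪ ⁅ fromℕ< k<m ⁆) - f [k]∖x - ∑ ys (λ y → prefixWeight k<m (y ∷ʳ inside)) ≈
      prefixWeight k<m (x ∷ʳ inside)
    Δ-correct {k} k<m x {ys} unique ys⊆x x∉ys complete = begin
      f T¹ - f T⁰ - Σ       ≈⟨ +-congʳ (+-congʳ f¹≈) ⟩
      f T⁰ + (Σ + w) - f T⁰ - Σ ≈⟨ +-congʳ (xyx⁻¹≈y (f T⁰) _) ⟩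
      Σ + w - Σ             ≈⟨ xyx⁻¹≈y Σ w ⟩
      w                     ∎
      where
      open ≈-Reasoning
      k≤m = ℕ.<⇒≤ k<m
      T⁰ = padRight k≤m outside (∁ x)
      T¹ = T⁰ ∪ ⁅ fromℕ< k<m ⁆
      w  = prefixWeight k<m (x ∷ʳ inside)
      Σ  = ∑ ys (λ y → prefixWeight k<m (y ∷ʳ inside))
      D : Subset m → Carrier
      D T = ∑ (subsets m) (λ T′ → disjoint T′ T ⊙ V T′)

      pointwise : ∀ T → disjoint T T⁰ ⊙ V T ≈
        (disjoint T T¹ ⊙ V T) +
          (∑ ys (λ y → does (truncate k<m T ≟ y ∷ʳ inside) ⊙ V T) +
            (does (truncate k<m T ≟ x ∷ʳ inside) ⊙ V T))
      -- The hypothesis that strictly smaller traces are in `ys` is available only for sets of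
      -- non-zero weight; for the others both sides are 0.
      pointwise T with V T Order.≟ 0#
      ... | yes V≈0 = trans (⊙-zero (disjoint T T⁰) V≈0) (sym
        (trans (+-cong (⊙-zero (disjoint T T¹) V≈0)
          (trans (+-cong (∑-zero (All.universal (λ y → ⊙-zero (does (truncate k<m T ≟ y ∷ʳ inside)) V≈0) ys))
                         (⊙-zero (does (truncate k<m T ≟ x ∷ʳ inside)) V≈0))
                 (+-identityˡ 0#)))
          (+-identityˡ 0#)))
      ... | no  V≉0
        rewrite disjoint-∪⁅⁆ T T⁰ (fromℕ< k<m) | disjoint-∁ k≤m T x | truncate-∷ʳ k<m T =
        split-below (truncate k≤m T) (Vec.lookup T (fromℕ< k<m)) (V T) unique ys⊆x x∉ys (complete T V≉0)

      D⁰≈ : D T⁰ ≈ D T¹ + (Σ + w)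
      D⁰≈ = begin
        D T⁰   ≈⟨ ∑-cong (subsets m) pointwise ⟩
        _      ≈⟨ ∑-+ (subsets m) _ _ ⟩
        _      ≈⟨ +-congˡ (∑-+ (subsets m) _ _) ⟩
        -- Exchanging the sums over sets and over `ys` turns each inner sum into a prefix weight.
        _      ≈⟨ +-congˡ (+-congʳ (∑-swap (subsets m) ys _)) ⟩
        D T¹ + (Σ + w) ∎

      f¹≈ : f T¹ ≈ f T⁰ + (Σ + w)
      -- By `f-disjoint`, `f` gains from `T⁰` to `T¹` exactly what the disjoint sum `D` loses.
      f¹≈ = +-cancelʳ (D T¹) _ _ (begin
        f T¹ + D T¹               ≈⟨ trans (f-disjoint T¹) (sym (f-disjoint T⁰)) ⟩
        f T⁰ + D T⁰               ≈⟨ +-congˡ (trans D⁰≈ (+-comm _ _)) ⟩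
        f T⁰ + ((Σ + w) + D T¹)   ≈⟨ +-assoc _ _ _ ⟨
        f T⁰ + (Σ + w) + D T¹     ∎)

    -- Correctness of one run of Refine

    record LoopInvariant {k} (k<m : k ℕ.< m) (done todo : List (Entry k)) : Set (c Level.⊔ ℓ₁) where
      field
        done-unique : Unique (map proj₁ done)
        todo-unique : Unique (map proj₁ todo)
        fresh       : All (λ x → All (x ≢_) (map proj₁ done)) (map proj₁ todo)
        sorted      : AllPairs (λ x y → ∣ x ∣ ℕ.≤ ∣ y ∣) (map proj₁ todo)
        complete    : ∀ T → ¬ V T ≈ 0# → let x = truncate (ℕ.<⇒≤ k<m) T in
                      x ∈ map proj₁ done ⊎ x ∈ map proj₁ todo
        Δ-values    : All (λ e → proj₂ e ≈ prefixWeight k<m (proj₁ e ∷ʳ inside)) done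
        values      : All (λ e → proj₂ e ≈ prefixWeight (ℕ.<⇒≤ k<m) (proj₁ e)) todo

    loop-Δ : ∀ {k} {k<m : k ℕ.< m} {done todo x wx} → LoopInvariant k<m done ((x , wx) ∷ todo) →
      let [k]∖x = padRight (ℕ.<⇒≤ k<m) outside (∁ x) in
      f ([k]∖x ∪ ⁅ fromℕ< k<m ⁆) - f [k]∖x - ∑ (filter (λ e → proj₁ e ⊆? x) done) proj₂ ≈
      prefixWeight k<m (x ∷ʳ inside)
    loop-Δ {k} {k<m} {done} {todo} {x} invariant = trans
      (+-congˡ (-‿cong ∑-done))
      (Δ-correct k<m x (Unique.filter⁺ (_⊆? x) done-unique) (All.all-filter (_⊆? x) (map proj₁ done))
        (All.filter⁺ (_⊆? x) (All.head fresh)) smaller)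
      where
      open ≈-Reasoning
      open LoopInvariant invariant
      h : Subset k → Carrier
      h y = prefixWeight k<m (y ∷ʳ inside)
      ∑-done : ∑ (filter (λ e → proj₁ e ⊆? x) done) proj₂ ≈ ∑ (filter (_⊆? x) (map proj₁ done)) h
      ∑-done = begin
        ∑ (filter (λ e → proj₁ e ⊆? x) done) proj₂
          ≈⟨ ∑-cong-All (All.filter⁺ (λ e → proj₁ e ⊆? x) Δ-values) ⟩
        ∑ (filter (λ e → proj₁ e ⊆? x) done) (h ∘ proj₁)
          ≡⟨ ∑-map proj₁ (filter (λ e → proj₁ e ⊆? x) done) h ⟨
        ∑ (map proj₁ (filter (λ e → proj₁ e ⊆? x) done)) h
          ≡⟨ ≡.cong (λ ys → ∑ ys h) (map-filter (_⊆? x) proj₁ done) ⟩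
        ∑ (filter (_⊆? x) (map proj₁ done)) h ∎
      smaller : ∀ T → ¬ V T ≈ 0# → let p = truncate (ℕ.<⇒≤ k<m) T in
                p ⊆ x → p ≢ x → p ∈ filter (_⊆? x) (map proj₁ done)
      smaller T V≉0 p⊆x p≢x with complete T V≉0
      ... | inj₁ p∈done         = Membership.∈-filter⁺ (_⊆? x) p∈done p⊆x
      ... | inj₂ (here p≡x)     = contradiction p≡x p≢x
      ... | inj₂ (there p∈todo) = contradiction
        (⊆∧∣≥∣⇒≡ _ x p⊆x (All.lookup (AllPairs.head sorted) p∈todo)) p≢x

    loop-step : ∀ {k} {k<m : k ℕ.< m} {done todo x wx Δ} →
      LoopInvariant k<m done ((x , wx) ∷ todo) → Δ ≈ prefixWeight k<m (x ∷ʳ inside) →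
      LoopInvariant k<m ((x , Δ) ∷ done) todo
    loop-step {k} {k<m} {done} {todo} {x} invariant Δ≈ = record
      { done-unique = All.head fresh ∷ done-unique
      ; todo-unique = AllPairs.tail todo-unique
      ; fresh       = All.zipWith (λ (x≢y , y∉done) → (x≢y ∘ ≡.sym) ∷ y∉done)
                                  (AllPairs.head todo-unique , All.tail fresh)
      ; sorted      = AllPairs.tail sorted
      ; complete    = complete′
      ; Δ-values    = Δ≈ ∷ Δ-values
      ; values      = All.tail values
      }
      where
      open LoopInvariant invariant
      complete′ : ∀ T → ¬ V T ≈ 0# → let y = truncate (ℕ.<⇒≤ k<m) T in
                  y ∈ x ∷ map proj₁ done ⊎ y ∈ map proj₁ todo
      complete′ T V≉0 with complete T V≉0
      ... | inj₁ y∈done         = inj₁ (there y∈done)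
      ... | inj₂ (here y≡x)     = inj₁ (here y≡x)
      ... | inj₂ (there y∈todo) = inj₂ y∈todo

    refineLoop-values : ∀ {k} {k<m : k ℕ.< m} {done todo} → LoopInvariant k<m done todo →
      All (λ e → proj₂ e ≈ prefixWeight k<m (proj₁ e)) (result f (refineLoop k<m done todo))
    refineLoop-values {todo = []} invariant = []
    refineLoop-values {k<m = k<m} {done} {(x , wx) ∷ L} invariant =
      ≡.subst (All _) (≡.sym (result->>= f (refineLoop k<m _ L) _))
        (rest≈ ∷ Δ≈ ∷ refineLoop-values (loop-step invariant Δ≈))
      where
      open ≈-Reasoning
      open LoopInvariant invariant
      Δ≈ = loop-Δ invariant
      w⁰ = prefixWeight k<m (x ∷ʳ outside)
      w¹ = prefixWeight k<m (x ∷ʳ inside)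
      rest≈ = begin
        wx - _         ≈⟨ +-cong (All.head values) (-‿cong Δ≈) ⟩
        prefixWeight (ℕ.<⇒≤ k<m) x - w¹
                       ≈⟨ +-congʳ (trans (sym (prefixWeight-split k<m x)) (+-comm w⁰ w¹)) ⟩
        w¹ + w⁰ - w¹   ≈⟨ xyx⁻¹≈y w¹ w⁰ ⟩
        w⁰             ∎

    -- Correctness of the list between rounds

    record Correct {k} (k≤m : k ℕ.≤ m) (L : List (Entry k)) : Set (c Level.⊔ ℓ₁) where
      field
        unique   : Unique (map proj₁ L)
        complete : ∀ T → ¬ V T ≈ 0# → truncate k≤m T ∈ map proj₁ L
        values   : All (λ e → proj₂ e ≈ prefixWeight k≤m (proj₁ e)) L

    -- Kept apart from `Correct` because it needs the positivity filter: the starting list and the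
    -- raw output of Refine may contain vectors of weight 0 that are traces of no `S i`.
    Prefixes : ∀ {k} → k ℕ.≤ m → List (Entry k) → Set c
    Prefixes k≤m = All (λ e → ∃ λ i → proj₁ e ≡ truncate k≤m (S i))

    onlyPositive-correct : ∀ {k} {k≤m : k ℕ.≤ m} {L} → Correct k≤m L → Correct k≤m (onlyPositive L)
    onlyPositive-correct {k≤m = k≤m} {L} correct = record
      { unique   = AllPairs.map⁺ (AllPairs.filter⁺ positive? (AllPairs.map⁻ unique))
      ; complete = complete′
      ; values   = All.filter⁺ positive? values
      }
      where
      open Correct correct
      positive? : Decidable (λ e → 0# < proj₂ e)
      positive? e = 0# <? proj₂ e
      complete′ : ∀ T → ¬ V T ≈ 0# → truncate k≤m T ∈ map proj₁ (onlyPositive L)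
      complete′ T V≉0 with (x , w) , e∈L , ≡.refl ← Membership.∈-map⁻ proj₁ (complete T V≉0) =
        let w≈       = All.lookup values e∈L
            0≤p , 0≉p = prefixWeight-positive k≤m T V≉0
        in Membership.∈-map⁺ proj₁ (Membership.∈-filter⁺ positive? e∈L
             (Order.≤-respʳ-≈ (sym w≈) 0≤p , λ 0≈w → 0≉p (trans 0≈w w≈)))

    onlyPositive-prefixes : ∀ {k} {k≤m : k ℕ.≤ m} {L} → Correct k≤m L → Prefixes k≤m (onlyPositive L)
    onlyPositive-prefixes {k≤m = k≤m} {L} correct =
      All.zipWith (λ {e} ((_ , 0≉w) , w≈) →
                     prefixWeight-support k≤m (proj₁ e) λ w≈0 → 0≉w (sym (trans w≈ w≈0)))
                  (All.all-filter (λ e → 0# <? proj₂ e) L , All.filter⁺ _ (Correct.values correct))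

    length-onlyPositive : ∀ {k} {k≤m : k ℕ.≤ m} {L} → Correct k≤m L → length (onlyPositive L) ℕ.≤ n
    length-onlyPositive {k≤m = k≤m} {L} correct =
      ≡.subst (ℕ._≤ n) (List.length-map proj₁ (onlyPositive L))
        (length≤ (truncate k≤m ∘ S) (Correct.unique (onlyPositive-correct correct))
                 (All.map⁺ (onlyPositive-prefixes correct)))

    correct-resp-↭ : ∀ {k} {k≤m : k ℕ.≤ m} {L L′} → L ↭ L′ → Correct k≤m L → Correct k≤m L′
    correct-resp-↭ L↭L′ correct = record
      { unique   = PermSetoid.Unique-resp-↭ (≡.setoid _) (↭⇒↭ₛ keys↭) unique
      ; complete = λ T V≉0 → Perm.∈-resp-↭ keys↭ (complete T V≉0)
      ; values   = Perm.All-resp-↭ L↭L′ values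
      }
      where
      open Correct correct
      keys↭ = Perm.map⁺ proj₁ L↭L′

    -- The computed values are replaced in place by `W f`, after which each entry is determined by
    -- its vector. It remains to permute the vectors, and duplicate-free lists with the same members
    -- are permutations of each other.
    correct⇒≋ : ∀ {L} → Correct ℕ.≤-refl L → Prefixes ℕ.≤-refl L → L ≋ tabulate (λ i → S i , W f (S i))
    correct⇒≋ {L} correct prefixes = Homogeneous.trans (Homogeneous.refl (weights (All.zip (values , sets))))
      (≡.subst (map withWeight (map proj₁ L) ≋_) (List.map-tabulate S withWeight)
        (Homogeneous.map (λ { ≡.refl → ≡.refl , refl }) (↭⇒↭ₛ (Perm.map⁺ withWeight keys↭))))
      where
      open Correct correct
      withWeight : Subset m → Entry m
      withWeight T = T , W f T
      sets : All (λ e → ∃ λ i → proj₁ e ≡ S i) L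
      sets = All.map (λ (i , eq) → i , ≡.trans eq (Vec.truncate-refl (S i))) prefixes
      keys↭ : map proj₁ L ↭ tabulate S
      keys↭ = ∼bag⇒↭ (unique∧set⇒bag unique (Unique.tabulate⁺ distinct) (mk⇔
        (λ x∈keys → let i , x≡S = All.lookup (All.map⁺ {f = proj₁} sets) x∈keys in
                    ≡.subst (_∈ tabulate S) (≡.sym x≡S) (Membership.∈-tabulate⁺ i))
        (λ x∈sets → let i , x≡S = Membership.∈-tabulate⁻ x∈sets in
                    ≡.subst (_∈ map proj₁ L) (≡.trans (Vec.truncate-refl (S i)) (≡.sym x≡S))
                      (complete (S i) (proj₂ (V-S-positive i) ∘ sym)))))
      weights : ∀ {L′} → All (λ e → proj₂ e ≈ prefixWeight ℕ.≤-refl (proj₁ e) ×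
                                    ∃ λ i → proj₁ e ≡ S i) L′ →
                Pointwise (λ e e′ → proj₁ e ≡ proj₁ e′ × proj₂ e ≈ proj₂ e′)
                          L′ (map withWeight (map proj₁ L′))
      weights []                              = []
      weights ((w≈ , i , ≡.refl) ∷ rest) =
        (≡.refl , trans w≈ (trans (prefixWeight-full (S i)) (V-S i))) ∷ weights rest

    -- All rounds together and the query bound

    module _ (order : TieBreaking) where

      refine-correct : ∀ {k} (k<m : k ℕ.< m) {L} → Correct (ℕ.<⇒≤ k<m) L →
                       Correct k<m (result f (refine order k<m L))
      refine-correct {k} k<m {L} correct = record
        { unique   = ≡.subst Unique (≡.sym keys≡) (children-unique unique)
        ; complete = λ T V≉0 → ≡.subst₂ _∈_ (≡.sym (truncate-∷ʳ k<m T)) (≡.sym keys≡)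
                       (∈-children (Vec.lookup T (fromℕ< k<m)) (complete T V≉0))
        ; values   = refineLoop-values record
            { done-unique = []
            ; todo-unique = unique
            ; fresh       = All.universal (λ _ → []) _
            ; sorted      = AllPairs.map⁺ (Linked.Linked⇒AllPairs ℕ.≤-trans (sort-↗ _))
            ; complete    = λ T V≉0 → inj₂ (complete T V≉0)
            ; Δ-values    = []
            ; values      = values
            }
        }
        where
        open SortingAlgorithm (order k)
        open Correct (correct-resp-↭ (↭-sym (sort-↭ (onlyPositive L))) (onlyPositive-correct correct))
        keys≡ = refineLoop-keys f k<m [] (sort (onlyPositive L))

      result-rounds-suc : ∀ {k} (k<m : k ℕ.< m) →
        result f (rounds order (suc k) k<m) ≡
        onlyPositive (result f (refine order k<m (result f (rounds order k (ℕ.<⇒≤ k<m)))))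
      result-rounds-suc {k} k<m = ≡.trans
        (result->>= f (rounds order k (ℕ.<⇒≤ k<m)) _)
        (result->>= f (refine order k<m (result f (rounds order k (ℕ.<⇒≤ k<m)))) _)

      rounds-correct : ∀ k (k≤m : k ℕ.≤ m) → Correct k≤m (result f (rounds order k k≤m))
      rounds-correct zero    k≤m = record
        { unique   = [] ∷ []
        ; complete = λ _ _ → here ≡.refl
        ; values   = f-⊤ ∷ []
        }
      rounds-correct (suc k) k<m = ≡.subst (Correct k<m) (≡.sym (result-rounds-suc k<m))
        (onlyPositive-correct (refine-correct k<m (rounds-correct k (ℕ.<⇒≤ k<m))))

      -- The extra 1 is the query of f(⊤) that starts the list. Refine filters its own input, so the
      -- bound `n` on the number of treated vectors holds already for the unfiltered starting list.
      rounds-queries : ∀ k (k≤m : k ℕ.≤ m) → queries f (rounds order k k≤m) ℕ.≤ suc (k ℕ.* (n ℕ.* 2))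
      rounds-queries zero    k≤m = ℕ.≤-refl
      rounds-queries (suc k) k<m = begin
        queries f (rounds order (suc k) k<m)
          ≡⟨ queries->>= f (rounds order k k≤m) _ ⟩
        queries f (rounds order k k≤m) ℕ.+ queries f (refine order k<m L >>= return ∘ onlyPositive)
          ≡⟨ ≡.cong (queries f (rounds order k k≤m) ℕ.+_)
               (≡.trans (queries-return f (refine order k<m L) onlyPositive)
                        (refineLoop-queries f k<m [] (sort (onlyPositive L)))) ⟩
        queries f (rounds order k k≤m) ℕ.+ length (sort (onlyPositive L)) ℕ.* 2
          ≡⟨ ≡.cong (λ l → queries f (rounds order k k≤m) ℕ.+ l ℕ.* 2) (Perm.↭-length (sort-↭ _)) ⟩
        queries f (rounds order k k≤m) ℕ.+ length (onlyPositive L) ℕ.* 2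
          ≤⟨ ℕ.+-mono-≤ (rounds-queries k k≤m)
                        (ℕ.*-monoˡ-≤ 2 (length-onlyPositive (rounds-correct k k≤m))) ⟩
        suc (k ℕ.* (n ℕ.* 2)) ℕ.+ n ℕ.* 2
          ≡⟨ ≡.cong suc (ℕ.+-comm (k ℕ.* (n ℕ.* 2)) _) ⟩
        suc (suc k ℕ.* (n ℕ.* 2)) ∎
        where
        open ℕ.≤-Reasoning
        open SortingAlgorithm (order k)
        k≤m = ℕ.<⇒≤ k<m
        L = result f (rounds order k k≤m)

      -- Level 0 is excluded because the starting list is unfiltered: if `n` is 0, its empty vector
      -- is a trace of no `S i`.
      rounds-prefixes : ∀ k (k≤m : k ℕ.≤ m) .{{_ : NonZero k}} →
                        Prefixes k≤m (result f (rounds order k k≤m))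
      rounds-prefixes (suc k) k<m = ≡.subst (Prefixes k<m) (≡.sym (result-rounds-suc k<m))
        (onlyPositive-prefixes (refine-correct k<m (rounds-correct k (ℕ.<⇒≤ k<m))))

      recoverCoverage-correct : .{{_ : NonZero m}} →
        result f (recoverCoverage order m) ≋ tabulate (λ i → S i , W f (S i))
      recoverCoverage-correct =
        correct⇒≋ (rounds-correct m ℕ.≤-refl) (rounds-prefixes m ℕ.≤-refl)

      -- The rounds cost at most 2mn queries, and the single initial query is absorbed by mn, which
      -- is at least 1 for non-zero `m` and `n`; this gives the constant 3.
      recoverCoverage-queries : .{{_ : NonZero m}} .{{_ : NonZero n}} →
        queries f (recoverCoverage order m) ℕ.≤ 3 ℕ.* (m ℕ.* n)
      recoverCoverage-queries = begin
        queries f (recoverCoverage order m)   ≤⟨ rounds-queries m ℕ.≤-refl ⟩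
        suc (m ℕ.* (n ℕ.* 2))                 ≤⟨ ℕ.+-monoˡ-≤ _ (ℕ.>-nonZero⁻¹ (m ℕ.* n) {{ℕ.m*n≢0 m n}}) ⟩
        m ℕ.* n ℕ.+ m ℕ.* (n ℕ.* 2)           ≡⟨ ≡.cong (m ℕ.* n ℕ.+_)
                                                   (≡.trans (≡.sym (ℕ.*-assoc m n 2)) (ℕ.*-comm (m ℕ.* n) 2)) ⟩
        3 ℕ.* (m ℕ.* n)                       ∎
        where open ℕ.≤-Reasoning

open import Data.Nat.Base using (_*_; _≤_)

theorem2p2 : ∀ {c ℓ₁ ℓ₂} (R : OrderedField c ℓ₁ ℓ₂) →
    let open OrderedField R using (Carrier)
        open Coverage R
    in
    ∃[ C ] (∀ (m : ℕ) .{{_ : NonZero m}} (n : ℕ) (f : Subset m → Carrier) (S : Fin n → Subset m) →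
      IsCoverage f → PositiveSets f S → (order : TieBreaking) →
      (result f (recoverCoverage order m) ≋ tabulate (λ i → S i , W f (S i)))
      × (.{{_ : NonZero n}} → queries f (recoverCoverage order m) ≤ C * (m * n)))
theorem2p2 R = 3 , λ m n f S coverage positiveSets order →
  let open Recovery R
      f-⊥ = coverage-⊥ coverage
  in recoverCoverage-correct f-⊥ positiveSets order ,
     recoverCoverage-queries f-⊥ positiveSets order
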